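{- Let $f \in \operatorname{Perm}$ and $\Pi = \operatorname{Part} f$. The following are equivalent: (a) $\mathrm{CF}(f) = \{x : |[x]_f| < \infty\}$ is decidable; (b) there is a total recursive function $\rho$ with $\rho(x) = 0$ if $|P(x,\Pi)| = \infty$ and $\rho(x) = |P(x,\Pi)|$ otherwise; (c) $f$ is effectively conjugate to its semi-normal form (i.e. the semi-normal form is recursive and conjugate to $f$ via some element of $\mathcal{G}$).
   Context: $\mathcal{G}$ is the group of recursive permutations of $\mathbb{N}$; $[x]_f=\{f^k(x):k\in\mathbb{Z}\}$, $\operatorname{Part} f = \{[x]_f\}$, $P(x,\Pi)$ the block of $x$. $\operatorname{Perm}$ is the set of $f\in\mathcal{G}$ for which $x\equiv_f x'$ (i.e. $x'\in[x]_f$) is decidable. Let $\delta:\mathbb{Z}\to\mathbb{N}$, $\delta(0)=0$, $\delta(k)=2k$ ($k>0$), $\delta(k)=-2k-1$ ($k<0$). A permutation is semi-normal if every infinite cycle with least element $a_0$ has $j\mapsto f^{\delta^{ -1}(j)}(a_0)$ strictly increasing for all $j\ge 0$, and every finite cycle of length $n$ with least element $a_0$ has $j\mapsto f^j(a_0)$ strictly increasing for $0\le j<n$. For every permutation $f$ there is a unique (possibly non-recursive) semi-normal permutation with the same cycles, its semi-normal form. -}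

module Defs where

open import Data.Nat using (ℕ; zero; suc; _<_; _≤_; _*_; _+_)
open import Data.Integer using (ℤ; +_; -[1+_])
open import Data.Fin using (Fin)
open import Data.Product using (Σ; ∃; _×_; _,_)
open import Function using (_∘_)
open import Function.Definitions using (Injective)
open import Function.Bundles using (_⇔_)
open import Relation.Binary.PropositionalEquality using (_≡_)
open import Relation.Nullary using (¬_; Dec)

-- Synthetic computability: "recursive" = definable as an Agda function.
-- An element of 𝒢: a (recursive) permutation of ℕ, given with its inverse.
record RecPerm : Set where
  field
    fun  : ℕ → ℕ
    inv  : ℕ → ℕ
    inv-fun : ∀ x → inv (fun x) ≡ x
    fun-inv : ∀ x → fun (inv x) ≡ x
open RecPerm public

iter : (ℕ → ℕ) → ℕ → ℕ → ℕ
iter h zero    x = x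
iter h (suc n) x = h (iter h n x)

pow : RecPerm → ℤ → ℕ → ℕ
pow f (+ n)      = iter (fun f) n
pow f -[1+ n ]   = iter (inv f) (suc n)

_≡[_]_ : ℕ → RecPerm → ℕ → Set
x ≡[ f ] y = ∃ λ (k : ℤ) → pow f k x ≡ y

InPerm : RecPerm → Set
InPerm f = ∀ x y → Dec (x ≡[ f ] y)

HasSize : RecPerm → ℕ → ℕ → Set
HasSize f x n =
  Σ (Fin n → ℕ) λ e →
    Injective _≡_ _≡_ e ×
    (∀ i → x ≡[ f ] e i) ×
    (∀ y → x ≡[ f ] y → ∃ λ i → e i ≡ y)

FiniteCycle : RecPerm → ℕ → Set
FiniteCycle f x = ∃ λ n → HasSize f x n

InfiniteCycle : RecPerm → ℕ → Set
InfiniteCycle f x = ¬ FiniteCycle f x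

δ : ℤ → ℕ
δ (+ zero)    = 0
δ (+ suc k)   = 2 * suc k
δ -[1+ k ]    = 2 * k + 1

δ⁻¹ : ℕ → ℤ
δ⁻¹ zero          = + 0
δ⁻¹ (suc zero)    = -[1+ 0 ]
δ⁻¹ (suc (suc j)) = step (δ⁻¹ j)
  where
  step : ℤ → ℤ
  step (+ k)    = + suc k
  step -[1+ k ] = -[1+ suc k ]

LeastInCycle : RecPerm → ℕ → Set
LeastInCycle g a = ∀ y → a ≡[ g ] y → a ≤ y

SemiNormal : RecPerm → Set
SemiNormal g = ∀ a → LeastInCycle g a →
  (InfiniteCycle g a → ∀ j → pow g (δ⁻¹ j) a < pow g (δ⁻¹ (suc j)) a) ×
  (∀ n → HasSize g a n → ∀ j → suc j < n → iter (fun g) j a < iter (fun g) (suc j) a)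

SameCycles : RecPerm → RecPerm → Set
SameCycles f g = ∀ x y → (x ≡[ f ] y) ⇔ (x ≡[ g ] y)

CFDecidable : RecPerm → Set
CFDecidable f = ∀ x → Dec (FiniteCycle f x)

CycleSizeFn : RecPerm → Set
CycleSizeFn f = Σ (ℕ → ℕ) λ ρ → ∀ x →
  (InfiniteCycle f x → ρ x ≡ 0) × (∀ n → HasSize f x n → ρ x ≡ n)

EffConjSemiNormal : RecPerm → Set
EffConjSemiNormal f = Σ RecPerm λ g →
  SemiNormal g × SameCycles f g ×
  Σ RecPerm λ h → ∀ x → fun g x ≡ fun h (fun f (inv h x))

-- A cycle of f is finite iff its points have a period, so (a) and (b) are interchangeable: a
-- decision for finiteness lets one compute the least period, and a cycle-size function bounds
-- the search for it. For (c) ⇒ (a), let a be the least point of a cycle of the semi-normal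
-- form g. If the cycle is infinite then g⁻¹ a < g a; if it has length n then g⁻¹ a = gⁿ⁻¹ a
-- is its largest point and n ≤ g⁻¹ a + 1. So comparing g⁻¹ a with g a decides finiteness.
-- For (a) ⇒ (c), decidability of ≡_f computes the least point a of every cycle, and
-- decidability of finiteness bounds the search for the next larger point of a cycle, so the
-- points s₀ < s₁ < ⋯ of each cycle are computable. The map h sending fᵏ(a) to s_δ(k) on an
-- infinite cycle and fʲ(a) to sⱼ (j < n) on a cycle of length n is then a recursive
-- permutation, and h f h⁻¹ is the semi-normal form of f.

module Submission where

open import Defs
open import Data.Product using (_×_)
open import Function.Bundles using (_⇔_)

open import Data.Nat using (ℕ; zero; suc; _+_; _*_; _∸_; _≤_; _<_; z≤n; s≤s; _⊔_)
open import Data.Nat.Properties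
open import Data.Nat.DivMod using (_%_; _/_; m≡m%n+[m/n]*n; m%n<n)
open import Data.Integer using (ℤ; +_; -[1+_])
open import Data.Fin using (Fin; toℕ; fromℕ<)
open import Data.Fin.Properties using (toℕ-injective; toℕ<n; pigeonhole; injective⇒≤; <⇒notInjective; toℕ-fromℕ<)
open import Data.Product using (Σ; ∃; _,_; proj₁; proj₂)
open import Data.Sum using (_⊎_; inj₁; inj₂)
open import Data.Empty using (⊥-elim)
open import Relation.Nullary using (¬_; Dec; yes; no)
open import Relation.Nullary.Decidable using (map′)
open import Relation.Binary.PropositionalEquality
open import Relation.Binary.Definitions using (tri<; tri≈; tri>)
open import Function.Bundles using (mk⇔; Equivalence)

iter-suc : ∀ (h : ℕ → ℕ) n x → iter h (suc n) x ≡ iter h n (h x)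
iter-suc h zero    x = refl
iter-suc h (suc n) x = cong h (iter-suc h n x)

iter-+ : ∀ (h : ℕ → ℕ) m n x → iter h (m + n) x ≡ iter h m (iter h n x)
iter-+ h zero    n x = refl
iter-+ h (suc m) n x = cong h (iter-+ h m n x)

iter-comm : ∀ (h : ℕ → ℕ) m n x → iter h m (iter h n x) ≡ iter h n (iter h m x)
iter-comm h m n x = begin
  iter h m (iter h n x) ≡⟨ iter-+ h m n x ⟨
  iter h (m + n) x      ≡⟨ cong (λ t → iter h t x) (+-comm m n) ⟩
  iter h (n + m) x      ≡⟨ iter-+ h n m x ⟩
  iter h n (iter h m x) ∎
  where open ≡-Reasoning

record LeastBelow (P : ℕ → Set) (b : ℕ) : Set where
  constructor least
  field
    value   : ℕ
    value<b : value < b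
    holds   : P value
    minimal : ∀ z → z < value → ¬ P z
open LeastBelow

least-≤ : ∀ {P : ℕ → Set} {b} (l : LeastBelow P b) {z} → P z → value l ≤ z
least-≤ l {z} pz with value l ≤? z
... | yes le = le
... | no nle = ⊥-elim (minimal l z (≰⇒> nle) pz)

leastBelow? : {P : ℕ → Set} → (∀ n → Dec (P n)) → (b : ℕ) → LeastBelow P b ⊎ (∀ z → z < b → ¬ P z)
leastBelow? P? zero = inj₂ (λ z ())
leastBelow? P? (suc b) with leastBelow? P? b
... | inj₁ (least v v<b p min) = inj₁ (least v (m<n⇒m<1+n v<b) p min)
... | inj₂ none with P? b
...   | yes p = inj₁ (least b (n<1+n b) p none)
...   | no ¬p = inj₂ none≤b
  where
  none≤b : ∀ z → z < suc b → ¬ _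
  none≤b z z<sb with m<1+n⇒m<n∨m≡n z<sb
  ... | inj₁ z<b  = none z z<b
  ... | inj₂ refl = ¬p

module IncreasingBelow (s : ℕ → ℕ) (N : ℕ) (step : ∀ j → suc j < N → s j < s (suc j)) where
  mono-≤ : ∀ i k → i ≤ k → k < N → s i ≤ s k
  mono-≤ i zero    z≤n  _    = ≤-refl
  mono-≤ i (suc k) i≤sk sk<N with m≤n⇒m<n∨m≡n i≤sk
  ... | inj₂ refl = ≤-refl
  ... | inj₁ i<sk = ≤-trans (mono-≤ i k (≤-pred i<sk) (<-trans (n<1+n k) sk<N)) (<⇒≤ (step k sk<N))

  mono-< : ∀ i k → i < k → k < N → s i < s k
  mono-< i (suc k) i<sk sk<N = ≤-<-trans (mono-≤ i k (≤-pred i<sk) (<-trans (n<1+n k) sk<N)) (step k sk<N)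

  index≤ : ∀ i → i < N → i ≤ s i
  index≤ zero    _    = z≤n
  index≤ (suc i) si<N = ≤-trans (s≤s (index≤ i (<-trans (n<1+n i) si<N))) (step i si<N)

  injective : ∀ i k → i < N → k < N → s i ≡ s k → i ≡ k
  injective i k i<N k<N e with <-cmp i k
  ... | tri< i<k _ _ = ⊥-elim (<⇒≢ (mono-< i k i<k k<N) e)
  ... | tri≈ _ i≡k _ = i≡k
  ... | tri> _ _ k<i = ⊥-elim (<⇒≢ (mono-< k i k<i i<N) (sym e))

module Cycles (f : RecPerm) where
  F F⁻¹ : ℕ → ℕ
  F   = fun f
  F⁻¹ = inv f

  _~_ : ℕ → ℕ → Set
  x ~ y = x ≡[ f ] y

  iter-F⁻¹-F : ∀ n x → iter F⁻¹ n (iter F n x) ≡ x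
  iter-F⁻¹-F zero    x = refl
  iter-F⁻¹-F (suc n) x = begin
    iter F⁻¹ (suc n) (F (iter F n x)) ≡⟨ iter-suc F⁻¹ n _ ⟩
    iter F⁻¹ n (F⁻¹ (F (iter F n x))) ≡⟨ cong (iter F⁻¹ n) (inv-fun f _) ⟩
    iter F⁻¹ n (iter F n x)           ≡⟨ iter-F⁻¹-F n x ⟩
    x                                 ∎
    where open ≡-Reasoning

  iter-F-F⁻¹ : ∀ n x → iter F n (iter F⁻¹ n x) ≡ x
  iter-F-F⁻¹ zero    x = refl
  iter-F-F⁻¹ (suc n) x = begin
    iter F (suc n) (F⁻¹ (iter F⁻¹ n x)) ≡⟨ iter-suc F n _ ⟩
    iter F n (F (F⁻¹ (iter F⁻¹ n x)))   ≡⟨ cong (iter F n) (fun-inv f _) ⟩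
    iter F n (iter F⁻¹ n x)             ≡⟨ iter-F-F⁻¹ n x ⟩
    x                                   ∎
    where open ≡-Reasoning

  iter-F-injective : ∀ n {x y} → iter F n x ≡ iter F n y → x ≡ y
  iter-F-injective n {x} {y} eq = trans (sym (iter-F⁻¹-F n x)) (trans (cong (iter F⁻¹ n) eq) (iter-F⁻¹-F n y))

  -- Working with two forward exponents avoids case analysis on the sign of k.
  Meet : ℕ → ℕ → Set
  Meet x y = Σ ℕ λ m → Σ ℕ λ n → iter F m x ≡ iter F n y

  ~⇒Meet : ∀ {x y} → x ~ y → Meet x y
  ~⇒Meet (+ n , p) = n , 0 , p
  ~⇒Meet {x} (-[1+ n ] , p) = 0 , suc n , trans (sym (iter-F-F⁻¹ (suc n) x)) (cong (iter F (suc n)) p)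

  Meet⇒~ : ∀ {x y} → Meet x y → x ~ y
  Meet⇒~ {x} {y} (m , n , p) with n ≤? m
  ... | yes n≤m = + (m ∸ n) , iter-F-injective n (begin
    iter F n (iter F (m ∸ n) x) ≡⟨ iter-+ F n (m ∸ n) x ⟨
    iter F (n + (m ∸ n)) x      ≡⟨ cong (λ t → iter F t x) (m+[n∸m]≡n n≤m) ⟩
    iter F m x                  ≡⟨ p ⟩
    iter F n y                  ∎)
    where open ≡-Reasoning
  ... | no n≰m = -[1+ d ] , trans (cong (iter F⁻¹ (suc d)) x≡F^[1+d]y) (iter-F⁻¹-F (suc d) y)
    where
    d = n ∸ suc m
    m+1+d≡n : m + suc d ≡ n
    m+1+d≡n = trans (cong (λ t → m + t) (sym (+-∸-assoc 1 (≰⇒> n≰m)))) (m+[n∸m]≡n (<⇒≤ (≰⇒> n≰m)))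
    x≡F^[1+d]y : x ≡ iter F (suc d) y
    x≡F^[1+d]y = iter-F-injective m (trans p (trans (cong (λ t → iter F t y) (sym m+1+d≡n)) (iter-+ F m (suc d) y)))

  ~-refl : ∀ {x} → x ~ x
  ~-refl = + 0 , refl

  ~-sym : ∀ {x y} → x ~ y → y ~ x
  ~-sym p with ~⇒Meet p
  ... | m , n , q = Meet⇒~ (n , m , sym q)

  ~-trans : ∀ {x y z} → x ~ y → y ~ z → x ~ z
  ~-trans {x} {y} {z} p q with ~⇒Meet p | ~⇒Meet q
  ... | m , n , p′ | m′ , n′ , q′ = Meet⇒~ (m′ + m , n + n′ , (begin
    iter F (m′ + m) x      ≡⟨ iter-+ F m′ m x ⟩
    iter F m′ (iter F m x) ≡⟨ cong (iter F m′) p′ ⟩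
    iter F m′ (iter F n y) ≡⟨ iter-comm F m′ n y ⟩
    iter F n (iter F m′ y) ≡⟨ cong (iter F n) q′ ⟩
    iter F n (iter F n′ z) ≡⟨ iter-+ F n n′ z ⟨
    iter F (n + n′) z      ∎))
    where open ≡-Reasoning

  ~-iter : ∀ k x → x ~ iter F k x
  ~-iter k x = + k , refl

  repeat⇒period : ∀ {x} i j → i < j → iter F i x ≡ iter F j x → iter F (j ∸ i) x ≡ x
  repeat⇒period {x} i j i<j eq = iter-F-injective i (begin
    iter F i (iter F (j ∸ i) x) ≡⟨ iter-+ F i (j ∸ i) x ⟨
    iter F (i + (j ∸ i)) x      ≡⟨ cong (λ t → iter F t x) (m+[n∸m]≡n (<⇒≤ i<j)) ⟩
    iter F j x                  ≡⟨ eq ⟨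
    iter F i x                  ∎)
    where open ≡-Reasoning

  IsPeriod : ℕ → ℕ → Set
  IsPeriod x p = 0 < p × iter F p x ≡ x

  IsLeastPeriod : ℕ → ℕ → Set
  IsLeastPeriod x p = IsPeriod x p × (∀ q → 0 < q → q < p → iter F q x ≢ x)

  isPeriod? : ∀ x p → Dec (IsPeriod x p)
  isPeriod? x zero = no (λ ())
  isPeriod? x (suc p) with iter F (suc p) x ≟ x
  ... | yes e = yes (s≤s z≤n , e)
  ... | no ne = no (λ q → ne (proj₂ q))

  leastPeriod : ∀ {x q} → IsPeriod x q → Σ ℕ (IsLeastPeriod x)
  leastPeriod {x} {q} pq with leastBelow? (isPeriod? x) (suc q)
  ... | inj₁ l    = value l , holds l , (λ q′ 0<q′ q′<p e → minimal l q′ q′<p (0<q′ , e))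
  ... | inj₂ none = ⊥-elim (none q (n<1+n q) pq)

  iter-*-period : ∀ {x p} → iter F p x ≡ x → ∀ q → iter F (q * p) x ≡ x
  iter-*-period e zero = refl
  iter-*-period {x} {p} e (suc q) = trans (iter-+ F p (q * p) x) (trans (cong (iter F p) (iter-*-period e q)) e)

  iter-+-*-period : ∀ {x p} → iter F p x ≡ x → ∀ r q → iter F (r + q * p) x ≡ iter F r x
  iter-+-*-period {x} {p} e r q = trans (iter-+ F r (q * p) x) (cong (iter F r) (iter-*-period e q))

  module LeastPeriodOrbit {x p′} (lp : IsLeastPeriod x (suc p′)) where
    private
      p = suc p′

    no-repeat : ∀ i j → i < j → j < p → iter F i x ≢ iter F j x
    no-repeat i j i<j j<p eq =
      proj₂ lp (j ∸ i) (m<n⇒0<n∸m i<j) (≤-<-trans (m∸n≤m j i) j<p) (repeat⇒period i j i<j eq)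

    iter-injective : ∀ i j → i < p → j < p → iter F i x ≡ iter F j x → i ≡ j
    iter-injective i j i<p j<p eq with <-cmp i j
    ... | tri< i<j _ _ = ⊥-elim (no-repeat i j i<j j<p eq)
    ... | tri≈ _ i≡j _ = i≡j
    ... | tri> _ _ j<i = ⊥-elim (no-repeat j i j<i i<p (sym eq))

    iter-covers : ∀ {y} → x ~ y → Σ ℕ λ k → k < p × iter F k x ≡ y
    iter-covers {y} xy with ~⇒Meet xy
    ... | m , n , e = c % p , m%n<n c p , (begin
      iter F (c % p) x               ≡⟨ iter-+-*-period period (c % p) (c / p) ⟨
      iter F (c % p + (c / p) * p) x ≡⟨ cong (λ t → iter F t x) (m≡m%n+[m/n]*n c p) ⟨
      iter F c x                     ≡⟨ F^c ⟩
      y                              ∎)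
      where
      open ≡-Reasoning
      period = proj₂ (proj₁ lp)
      -- c = (m - n) + n * p, written without truncated subtraction
      c = m + n * p′
      n+c≡m+n*p : n + c ≡ m + n * p
      n+c≡m+n*p = begin
        n + (m + n * p′) ≡⟨ +-assoc n m _ ⟨
        (n + m) + n * p′ ≡⟨ cong (_+ n * p′) (+-comm n m) ⟩
        (m + n) + n * p′ ≡⟨ +-assoc m n _ ⟩
        m + (n + n * p′) ≡⟨ cong (λ t → m + t) (*-suc n p′) ⟨
        m + n * p        ∎
      F^c : iter F c x ≡ y
      F^c = iter-F-injective n (begin
        iter F n (iter F c x) ≡⟨ iter-+ F n c x ⟨
        iter F (n + c) x      ≡⟨ cong (λ t → iter F t x) n+c≡m+n*p ⟩
        iter F (m + n * p) x  ≡⟨ iter-+-*-period period m n ⟩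
        iter F m x            ≡⟨ e ⟩
        iter F n y            ∎)

    hasSize : HasSize f x p
    hasSize = e , e-injective , (λ i → ~-iter (toℕ i) x) , e-covers
      where
      e : Fin p → ℕ
      e i = iter F (toℕ i) x
      e-injective : ∀ {i j} → e i ≡ e j → i ≡ j
      e-injective {i} {j} eq = toℕ-injective (iter-injective (toℕ i) (toℕ j) (toℕ<n i) (toℕ<n j) eq)
      e-covers : ∀ y → x ~ y → Σ (Fin p) λ i → e i ≡ y
      e-covers y xy with iter-covers xy
      ... | k , k<p , eq = fromℕ< k<p , trans (cong (λ t → iter F t x) (toℕ-fromℕ< k<p)) eq

  period⇒finite : ∀ {x q} → IsPeriod x q → FiniteCycle f x
  period⇒finite pq with leastPeriod pq
  ... | zero  , ((() , _) , _)
  ... | suc p , lp = suc p , LeastPeriodOrbit.hasSize lp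

  size-pos : ∀ {x n} → HasSize f x n → 0 < n
  size-pos {x} {zero} (_ , _ , _ , covers) with covers x ~-refl
  ... | () , _
  size-pos {x} {suc n} _ = s≤s z≤n

  slot : ∀ {x n} → HasSize f x n → ∀ {y} → x ~ y → Fin n
  slot (_ , _ , _ , covers) {y} xy = proj₁ (covers y xy)

  slot-injective : ∀ {x n} (hs : HasSize f x n) {y z} (xy : x ~ y) (xz : x ~ z) → slot hs xy ≡ slot hs xz → y ≡ z
  slot-injective (e , _ , _ , covers) {y} {z} xy xz eq =
    trans (sym (proj₂ (covers y xy))) (trans (cong e eq) (proj₂ (covers z xz)))

  size⇒period : ∀ {x n} → HasSize f x n → Σ ℕ λ q → IsPeriod x q × q ≤ n
  size⇒period {x} {n} hs with pigeonhole (n<1+n n) (λ i → slot hs (~-iter (toℕ i) x))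
  ... | i , j , i<j , same-slot =
    toℕ j ∸ toℕ i , (m<n⇒0<n∸m i<j , repeat⇒period (toℕ i) (toℕ j) i<j (slot-injective hs _ _ same-slot)) ,
    ≤-trans (m∸n≤m (toℕ j) (toℕ i)) (≤-pred (toℕ<n j))

  injection⇒≤size : ∀ {x n m} → HasSize f x n → (φ : Fin m → ℕ) →
                    (∀ {i j} → φ i ≡ φ j → i ≡ j) → (∀ i → x ~ φ i) → m ≤ n
  injection⇒≤size hs φ φ-injective φ-in =
    injective⇒≤ {f = λ i → slot hs (φ-in i)} (λ eq → φ-injective (slot-injective hs _ _ eq))

  size-unique : ∀ {x n m} → HasSize f x n → HasSize f x m → n ≡ m
  size-unique hn@(en , en-inj , en-in , _) hm@(em , em-inj , em-in , _) =
    ≤-antisym (injection⇒≤size hm en en-inj en-in) (injection⇒≤size hn em em-inj em-in)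

  size⇒leastPeriod : ∀ {x n} → HasSize f x n → IsLeastPeriod x n
  size⇒leastPeriod {x} hs with leastPeriod (proj₁ (proj₂ (size⇒period hs)))
  ... | zero  , ((() , _) , _)
  ... | suc p , lp = subst (IsLeastPeriod x) (size-unique (LeastPeriodOrbit.hasSize lp) hs) lp

  iter-size : ∀ {x n} → HasSize f x n → iter F n x ≡ x
  iter-size hs = proj₂ (proj₁ (size⇒leastPeriod hs))

  size-iter-injective : ∀ {x n i j} → HasSize f x n → i < n → j < n → iter F i x ≡ iter F j x → i ≡ j
  size-iter-injective {n = zero}  hs ()
  size-iter-injective {n = suc n} hs = LeastPeriodOrbit.iter-injective (size⇒leastPeriod hs) _ _

  size-iter-covers : ∀ {x n y} → HasSize f x n → x ~ y → Σ ℕ λ k → k < n × iter F k x ≡ y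
  size-iter-covers {n = zero}  hs xy = ⊥-elim (<-irrefl refl (size-pos hs))
  size-iter-covers {n = suc n} hs xy = LeastPeriodOrbit.iter-covers (size⇒leastPeriod hs) xy

  ~-size : ∀ {x y n} → x ~ y → HasSize f x n → HasSize f y n
  ~-size xy (e , e-inj , e-in , covers) = e , e-inj , (λ i → ~-trans (~-sym xy) (e-in i)) , (λ z yz → covers z (~-trans xy yz))

  module Infinite {x} (inf : InfiniteCycle f x) where
    iter-injective : ∀ i j → iter F i x ≡ iter F j x → i ≡ j
    iter-injective i j eq with <-cmp i j
    ... | tri< i<j _ _ = ⊥-elim (inf (period⇒finite (m<n⇒0<n∸m i<j , repeat⇒period i j i<j eq)))
    ... | tri≈ _ i≡j _ = i≡j
    ... | tri> _ _ j<i = ⊥-elim (inf (period⇒finite (m<n⇒0<n∸m j<i , repeat⇒period j i j<i (sym eq))))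

    -- among the w + 2 distinct points x, F x, …, F^(w+1) x one must exceed w
    unbounded : ∀ w → Σ ℕ λ k → k < suc (suc w) × w < iter F k x
    unbounded w with anyUpTo? (λ k → w <? iter F k x) (suc (suc w))
    ... | yes above = above
    ... | no none   = ⊥-elim (<⇒notInjective (n<1+n (suc w)) iterate-injective)
      where
      iterate : Fin (suc (suc w)) → Fin (suc w)
      iterate i = fromℕ< (s≤s (≮⇒≥ λ w<F^i → none (toℕ i , toℕ<n i , w<F^i)))
      iterate-injective : ∀ {i j} → iterate i ≡ iterate j → i ≡ j
      iterate-injective {i} {j} eq = toℕ-injective (iter-injective (toℕ i) (toℕ j)
        (trans (sym (toℕ-fromℕ< _)) (trans (cong toℕ eq) (toℕ-fromℕ< _))))

    pow-injective : ∀ k k′ → pow f k x ≡ pow f k′ x → k ≡ k′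
    pow-injective (+ i) (+ j) eq = cong +_ (iter-injective i j eq)
    pow-injective (+ i) -[1+ j ] eq with iter-injective (suc j + i) 0 (begin
      iter F (suc j + i) x                ≡⟨ iter-+ F (suc j) i x ⟩
      iter F (suc j) (iter F i x)         ≡⟨ cong (iter F (suc j)) eq ⟩
      iter F (suc j) (iter F⁻¹ (suc j) x) ≡⟨ iter-F-F⁻¹ (suc j) x ⟩
      x                                   ∎)
      where open ≡-Reasoning
    ... | ()
    pow-injective -[1+ i ] (+ j) eq = sym (pow-injective (+ j) -[1+ i ] (sym eq))
    pow-injective -[1+ i ] -[1+ j ] eq =
      cong -[1+_] (suc-injective (sym (iter-injective (suc j) (suc i) (begin
        iter F (suc j) x                                     ≡⟨ cong (iter F (suc j)) (iter-F-F⁻¹ (suc i) x) ⟨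
        iter F (suc j) (iter F (suc i) (iter F⁻¹ (suc i) x)) ≡⟨ iter-comm F (suc j) (suc i) _ ⟩
        iter F (suc i) (iter F (suc j) (iter F⁻¹ (suc i) x)) ≡⟨ cong (λ t → iter F (suc i) (iter F (suc j) t)) eq ⟩
        iter F (suc i) (iter F (suc j) (iter F⁻¹ (suc j) x)) ≡⟨ cong (iter F (suc i)) (iter-F-F⁻¹ (suc j) x) ⟩
        iter F (suc i) x                                     ∎))))
      where open ≡-Reasoning

SameCycles-sym : ∀ {f g} → SameCycles f g → SameCycles g f
SameCycles-sym same x y = mk⇔ (Equivalence.from (same x y)) (Equivalence.to (same x y))

SameCycles-size : ∀ {f g} → SameCycles f g → ∀ {x n} → HasSize f x n → HasSize g x n
SameCycles-size same (e , e-inj , e-in , covers) =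
  e , e-inj , (λ i → Equivalence.to (same _ _) (e-in i)) , (λ z p → covers z (Equivalence.from (same _ _) p))

period⇒iter≡inv : ∀ (g : RecPerm) m a → iter (fun g) (suc m) a ≡ a → iter (fun g) m a ≡ inv g a
period⇒iter≡inv g m a e = trans (sym (inv-fun g _)) (cong (inv g) e)

module _ (f : RecPerm) where
  open Cycles f

  CFDecidable⇒CycleSizeFn : CFDecidable f → CycleSizeFn f
  CFDecidable⇒CycleSizeFn finite? = ρ , ρ-spec
    where
    ρ : ℕ → ℕ
    ρ x with finite? x
    ... | yes (n , _) = n
    ... | no _        = 0
    ρ-spec : ∀ x → (InfiniteCycle f x → ρ x ≡ 0) × (∀ n → HasSize f x n → ρ x ≡ n)
    ρ-spec x with finite? x
    ... | yes (n , hs) = (λ inf → ⊥-elim (inf (n , hs))) , (λ m hm → size-unique hs hm)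
    ... | no inf       = (λ _ → refl) , (λ m hm → ⊥-elim (inf (m , hm)))

  -- ρ x = 0 rules out a finite cycle, and otherwise ρ x bounds the least period of x.
  CycleSizeFn⇒CFDecidable : CycleSizeFn f → CFDecidable f
  CycleSizeFn⇒CFDecidable (ρ , ρ-spec) x with ρ x in eq
  ... | zero = no λ (n , hs) → <⇒≢ (size-pos hs) (sym (trans (sym (proj₂ (ρ-spec x) n hs)) eq))
  ... | suc m with anyUpTo? (isPeriod? x) (suc (suc m))
  ...   | yes (_ , _ , period) = yes (period⇒finite period)
  ...   | no none = no λ (n , hs) →
    none (n , s≤s (≤-reflexive (trans (sym (proj₂ (ρ-spec x) n hs)) eq)) , size-pos hs , iter-size hs)

module Representatives (f : RecPerm) (_~?_ : InPerm f) where
  open Cycles f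

  rep : ℕ → ℕ
  rep y with leastBelow? (λ z → z ~? y) (suc y)
  ... | inj₁ l = value l
  ... | inj₂ _ = y

  rep-~ : ∀ y → rep y ~ y
  rep-~ y with leastBelow? (λ z → z ~? y) (suc y)
  ... | inj₁ l    = holds l
  ... | inj₂ none = ⊥-elim (none y (n<1+n y) ~-refl)

  rep-minimal : ∀ y z → z ~ y → rep y ≤ z
  rep-minimal y z zy with leastBelow? (λ z → z ~? y) (suc y)
  ... | inj₁ l    = least-≤ l zy
  ... | inj₂ none = ⊥-elim (none y (n<1+n y) ~-refl)

  rep-least : ∀ y → LeastInCycle f (rep y)
  rep-least y z az = rep-minimal y z (~-trans (~-sym az) (rep-~ y))

  rep-cong : ∀ {x y} → x ~ y → rep x ≡ rep y
  rep-cong {x} {y} xy = ≤-antisym (rep-minimal x (rep y) (~-trans (rep-~ y) (~-sym xy)))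
                                  (rep-minimal y (rep x) (~-trans (rep-~ x) xy))

  rep-self : ∀ {a} → LeastInCycle f a → rep a ≡ a
  rep-self {a} a-least = ≤-antisym (rep-minimal a a ~-refl) (a-least (rep a) (~-sym (rep-~ a)))

module SemiNormalCycle (g : RecPerm) (semiNormal : SemiNormal g) {a} (a-least : LeastInCycle g a) where
  open Cycles g

  increasing : ∀ {n} → HasSize g a n → ∀ j → suc j < n → iter F j a < iter F (suc j) a
  increasing {n} = proj₂ (semiNormal a a-least) n

  infinite⇒F⁻¹<F : InfiniteCycle g a → F⁻¹ a < F a
  infinite⇒F⁻¹<F inf = proj₁ (semiNormal a a-least) inf 1

  -- In a cycle of length m + 1 the point F⁻¹ a = F^m a is the largest one.
  finite⇒F≤F⁻¹ : FiniteCycle g a → F a ≤ F⁻¹ a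
  finite⇒F≤F⁻¹ (zero , hs) = ⊥-elim (<-irrefl refl (size-pos hs))
  finite⇒F≤F⁻¹ (suc zero , hs) = ≤-reflexive (trans (iter-size hs) (period⇒iter≡inv g 0 a (iter-size hs)))
  finite⇒F≤F⁻¹ (suc (suc m) , hs) = subst (F a ≤_) (period⇒iter≡inv g (suc m) a (iter-size hs))
    (IncreasingBelow.mono-≤ (λ j → iter F j a) (suc (suc m)) (increasing hs) 1 (suc m) (s≤s z≤n) ≤-refl)

  size≤1+F⁻¹ : ∀ {n} → HasSize g a n → n ≤ suc (F⁻¹ a)
  size≤1+F⁻¹ {zero}  hs = z≤n
  size≤1+F⁻¹ {suc m} hs = s≤s (subst (m ≤_) (period⇒iter≡inv g m a (iter-size hs))
    (IncreasingBelow.index≤ (λ j → iter F j a) (suc m) (increasing hs) m ≤-refl))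

  finite? : Dec (FiniteCycle g a)
  finite? with F⁻¹ a <? F a
  ... | yes F⁻¹<F = no λ fin → <⇒≱ F⁻¹<F (finite⇒F≤F⁻¹ fin)
  ... | no F⁻¹≮F with anyUpTo? (isPeriod? a) (suc (suc (F⁻¹ a)))
  ...   | yes (_ , _ , period) = yes (period⇒finite period)
  ...   | no none = ⊥-elim (F⁻¹≮F (infinite⇒F⁻¹<F λ (n , hs) →
    none (n , s≤s (size≤1+F⁻¹ hs) , size-pos hs , iter-size hs)))

EffConjSemiNormal⇒CFDecidable : (f : RecPerm) → InPerm f → EffConjSemiNormal f → CFDecidable f
EffConjSemiNormal⇒CFDecidable f _~?_ (g , semiNormal , same , _) x =
  map′ (λ (n , hs) → n , ~-size (rep-~ x) (SameCycles-size (SameCycles-sym same) hs))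
       (λ (n , hs) → n , SameCycles-size same (~-size (~-sym (rep-~ x)) hs))
       (SemiNormalCycle.finite? g semiNormal rep-x-least)
  where
  open Cycles f
  open Representatives f _~?_
  rep-x-least : LeastInCycle g (rep x)
  rep-x-least y p = rep-least x y (Equivalence.from (same (rep x) y) p)

δ⁻¹-even : ∀ k → δ⁻¹ (2 * k) ≡ + k
δ⁻¹-even zero = refl
δ⁻¹-even (suc k) rewrite *-suc 2 k | δ⁻¹-even k = refl

δ⁻¹-odd : ∀ k → δ⁻¹ (2 * k + 1) ≡ -[1+ k ]
δ⁻¹-odd zero = refl
δ⁻¹-odd (suc k) = trans (cong (λ t → δ⁻¹ (t + 1)) (*-suc 2 k)) two-more
  where
  two-more : δ⁻¹ (suc (suc (2 * k + 1))) ≡ -[1+ suc k ]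
  two-more rewrite δ⁻¹-odd k = refl

δ⁻¹-δ : ∀ z → δ⁻¹ (δ z) ≡ z
δ⁻¹-δ (+ zero)  = refl
δ⁻¹-δ (+ suc k) = δ⁻¹-even (suc k)
δ⁻¹-δ -[1+ k ]  = δ⁻¹-odd k

δ-δ⁻¹ : ∀ j → δ (δ⁻¹ j) ≡ j
δ-δ⁻¹ zero          = refl
δ-δ⁻¹ (suc zero)    = refl
δ-δ⁻¹ (suc (suc j)) = trans (δ-step j) (cong (λ t → suc (suc t)) (δ-δ⁻¹ j))
  where
  δ-step : ∀ j → δ (δ⁻¹ (suc (suc j))) ≡ suc (suc (δ (δ⁻¹ j)))
  δ-step j with δ⁻¹ j
  ... | + zero   = refl
  ... | + suc k  = *-suc 2 (suc k)
  ... | -[1+ k ] = cong (_+ 1) (*-suc 2 k)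

module SemiNormalForm (f : RecPerm) (_~?_ : InPerm f) (finite? : CFDecidable f) where
  open Cycles f
  open Representatives f _~?_

  ρ : ℕ → ℕ
  ρ = proj₁ (CFDecidable⇒CycleSizeFn f finite?)

  orbitMax : ℕ → ℕ → ℕ
  orbitMax a zero    = a
  orbitMax a (suc m) = iter F (suc m) a ⊔ orbitMax a m

  iter≤orbitMax : ∀ a k m → k ≤ m → iter F k a ≤ orbitMax a m
  iter≤orbitMax a zero    zero    _ = ≤-refl
  iter≤orbitMax a k       (suc m) k≤sm with m≤n⇒m<n∨m≡n k≤sm
  ... | inj₂ refl = m≤m⊔n _ _
  ... | inj₁ k<sm = ≤-trans (iter≤orbitMax a k m (≤-pred k<sm)) (m≤n⊔m _ _)

  AboveIn : ℕ → ℕ → ℕ → Set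
  AboveIn a w z = w < z × a ~ z

  aboveIn? : ∀ a w z → Dec (AboveIn a w z)
  aboveIn? a w z with w <? z | a ~? z
  ... | yes w<z | yes az = yes (w<z , az)
  ... | no w≮z  | _      = no (λ r → w≮z (proj₁ r))
  ... | yes _   | no a≁z = no (λ r → a≁z (proj₂ r))

  Above : ℕ → ℕ → Set
  Above a w = ∃ (AboveIn a w)

  bound : ℕ → ℕ → ℕ
  bound a w = orbitMax a (w + suc (ρ a))

  -- A finite cycle consists of its first ρ a = n iterates; on an infinite one (where ρ a = 0)
  -- one of the first w + 2 iterates exceeds w.
  above-within-bound : ∀ a w → Above a w → Σ ℕ λ z → AboveIn a w z × z ≤ bound a w
  above-within-bound a w (z , w<z , az) with finite? a
  ... | yes (n , hs) with size-iter-covers hs az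
  ...   | k , k<n , e = z , (w<z , az) ,
    subst (_≤ orbitMax a (w + suc n)) e (iter≤orbitMax a k _ (≤-trans (<⇒≤ k<n) (≤-trans (n≤1+n n) (m≤n+m _ w))))
  above-within-bound a w (z , w<z , az) | no inf with Infinite.unbounded inf w
  ... | k , k<2+w , w<F^k = iter F k a , (w<F^k , ~-iter k a) ,
    iter≤orbitMax a k _ (≤-trans (≤-pred k<2+w) (≤-reflexive (+-comm 1 w)))

  -- the least point of the cycle of a above w, or w itself if there is none
  next : ℕ → ℕ → ℕ
  next a w with leastBelow? (aboveIn? a w) (suc (bound a w))
  ... | inj₁ l = value l
  ... | inj₂ _ = w

  next-~ : ∀ {a w} → a ~ w → a ~ next a w
  next-~ {a} {w} aw with leastBelow? (aboveIn? a w) (suc (bound a w))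
  ... | inj₁ l = proj₂ (holds l)
  ... | inj₂ _ = aw

  next-above : ∀ a w → Above a w → w < next a w × (∀ z → AboveIn a w z → next a w ≤ z)
  next-above a w above with leastBelow? (aboveIn? a w) (suc (bound a w))
  ... | inj₁ l = proj₁ (holds l) , next≤
    where
    next≤ : ∀ z → AboveIn a w z → value l ≤ z
    next≤ z above-z with z ≤? bound a w
    ... | yes z≤b = least-≤ l above-z
    ... | no z≰b  = ≤-trans (≤-pred (value<b l)) (<⇒≤ (≰⇒> z≰b))
  ... | inj₂ none with above-within-bound a w above
  ...   | z , above-z , z≤b = ⊥-elim (none z (s≤s z≤b) above-z)

  next-none : ∀ a w → ¬ Above a w → next a w ≡ w
  next-none a w nothing-above with leastBelow? (aboveIn? a w) (suc (bound a w))
  ... | inj₁ l = ⊥-elim (nothing-above (value l , holds l))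
  ... | inj₂ _ = refl

  -- sorted a j is the (j+1)-st smallest point of the cycle of a, when a is its least point
  sorted : ℕ → ℕ → ℕ
  sorted a zero    = a
  sorted a (suc j) = next a (sorted a j)

  sorted-~ : ∀ a j → a ~ sorted a j
  sorted-~ a zero    = ~-refl
  sorted-~ a (suc j) = next-~ (sorted-~ a j)

  sorted-stuck : ∀ a j → ¬ Above a (sorted a j) → ∀ i → j ≤ i → sorted a i ≡ sorted a j
  sorted-stuck a j nothing-above i j≤i = trans (cong (sorted a) (sym (m∸n+n≡m j≤i))) (stuck (i ∸ j))
    where
    stuck : ∀ t → sorted a (t + j) ≡ sorted a j
    stuck zero    = refl
    stuck (suc t) = trans (cong (next a) (stuck t)) (next-none a (sorted a j) nothing-above)

  sorted-increasing-infinite : ∀ {a} → InfiniteCycle f a → ∀ j → sorted a j < sorted a (suc j)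
  sorted-increasing-infinite {a} inf j with Infinite.unbounded inf (sorted a j)
  ... | k , _ , above = proj₁ (next-above a (sorted a j) (iter F k a , above , ~-iter k a))

  rank : ℕ → ℕ → ℕ
  rank a y with leastBelow? (λ j → sorted a j ≟ y) (suc y)
  ... | inj₁ l = value l
  ... | inj₂ _ = 0

  module _ {a} (a-least : LeastInCycle f a) where
    -- As long as sorted a t < y, we have t ≤ sorted a t, so y is reached within y + 1 steps.
    sorted-covers : ∀ {y} → a ~ y → Σ ℕ λ j → j ≤ y × sorted a j ≡ y
    sorted-covers {y} ay with reached-or-below y
      where
      ReachedOrBelow : ℕ → Set
      ReachedOrBelow t = (Σ ℕ λ j → j ≤ t × sorted a j ≡ y) ⊎ (t ≤ sorted a t × sorted a t < y)
      reached-or-below : ∀ t → ReachedOrBelow t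
      reached-or-below zero with m≤n⇒m<n∨m≡n (a-least y ay)
      ... | inj₁ a<y = inj₂ (z≤n , a<y)
      ... | inj₂ a≡y = inj₁ (0 , z≤n , a≡y)
      reached-or-below (suc t) with reached-or-below t
      ... | inj₁ (j , j≤t , e) = inj₁ (j , m≤n⇒m≤1+n j≤t , e)
      ... | inj₂ (t≤s , s<y) with next-above a (sorted a t) (y , s<y , ay)
      ...   | s<next , next≤ with m≤n⇒m<n∨m≡n (next≤ y (s<y , ay))
      ...     | inj₂ next≡y  = inj₁ (suc t , ≤-refl , next≡y)
      ...     | inj₁ next<y  = inj₂ (≤-trans (s≤s t≤s) s<next , next<y)
    ... | inj₁ reached     = reached
    ... | inj₂ (y≤s , s<y) = ⊥-elim (<-irrefl refl (≤-<-trans y≤s s<y))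

    sorted-rank : ∀ {y} → a ~ y → sorted a (rank a y) ≡ y
    sorted-rank {y} ay with leastBelow? (λ j → sorted a j ≟ y) (suc y)
    ... | inj₁ l    = holds l
    ... | inj₂ none with sorted-covers ay
    ...   | j , j≤y , e = ⊥-elim (none j (s≤s j≤y) e)

    rank-minimal : ∀ {y j} → sorted a j ≡ y → rank a y ≤ j
    rank-minimal {y} e with leastBelow? (λ j → sorted a j ≟ y) (suc y)
    ... | inj₁ l = least-≤ l e
    ... | inj₂ _ = z≤n

    rank-sorted : ∀ m → (∀ i → suc i < suc m → sorted a i < sorted a (suc i)) → rank a (sorted a m) ≡ m
    rank-sorted m increasing = IncreasingBelow.injective (sorted a) (suc m) increasing _ m
      (s≤s (rank-minimal refl)) ≤-refl (sorted-rank (sorted-~ a m))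

    nothing-above⇒size≤ : ∀ {n j} → HasSize f a n → ¬ Above a (sorted a j) → n ≤ suc j
    nothing-above⇒size≤ {n} {j} hs nothing-above = injective⇒≤ index-injective
      where
      sorted-index : ∀ k → Σ ℕ λ i → i < suc j × sorted a i ≡ iter F k a
      sorted-index k with sorted-covers (~-iter k a)
      ... | i , _ , e with i ≤? j
      ...   | yes i≤j = i , s≤s i≤j , e
      ...   | no i≰j  = j , ≤-refl , trans (sym (sorted-stuck a j nothing-above i (<⇒≤ (≰⇒> i≰j)))) e
      index : Fin n → Fin (suc j)
      index k = fromℕ< (proj₁ (proj₂ (sorted-index (toℕ k))))
      index-injective : ∀ {k k′} → index k ≡ index k′ → k ≡ k′
      index-injective {k} {k′} eq = toℕ-injective (size-iter-injective hs (toℕ<n k) (toℕ<n k′) (begin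
        iter F (toℕ k) a                         ≡⟨ proj₂ (proj₂ (sorted-index (toℕ k))) ⟨
        sorted a (proj₁ (sorted-index (toℕ k)))  ≡⟨ cong (sorted a) same-index ⟩
        sorted a (proj₁ (sorted-index (toℕ k′))) ≡⟨ proj₂ (proj₂ (sorted-index (toℕ k′))) ⟩
        iter F (toℕ k′) a                        ∎))
        where
        open ≡-Reasoning
        same-index = trans (sym (toℕ-fromℕ< _)) (trans (cong toℕ eq) (toℕ-fromℕ< _))

    sorted-increasing-finite : ∀ {n} → HasSize f a n → ∀ j → suc j < n → sorted a j < sorted a (suc j)
    sorted-increasing-finite {n} hs j sj<n with anyUpTo? (λ k → sorted a j <? iter F k a) n
    ... | yes (k , _ , above) = proj₁ (next-above a (sorted a j) (iter F k a , above , ~-iter k a))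
    ... | no nothing-below-n  = ⊥-elim (<⇒≱ sj<n (nothing-above⇒size≤ hs nothing-above))
      where
      nothing-above : ¬ Above a (sorted a j)
      nothing-above (z , s<z , az) with size-iter-covers hs az
      ... | k , k<n , e = nothing-below-n (k , k<n , subst (_ <_) (sym e) s<z)

    nothing-above-last : ∀ {m} → HasSize f a (suc m) → ¬ Above a (sorted a m)
    nothing-above-last {m} hs above = <-irrefl refl
      (injection⇒≤size hs (λ i → sorted a (toℕ i)) sorted-injective (λ i → sorted-~ a (toℕ i)))
      where
      increasing : ∀ j → suc j < suc (suc m) → sorted a j < sorted a (suc j)
      increasing j sj<2+m with m≤n⇒m<n∨m≡n (≤-pred sj<2+m)
      ... | inj₁ sj<1+m = sorted-increasing-finite hs j sj<1+m
      ... | inj₂ refl   = proj₁ (next-above a (sorted a m) above)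
      sorted-injective : ∀ {i k : Fin (suc (suc m))} → sorted a (toℕ i) ≡ sorted a (toℕ k) → i ≡ k
      sorted-injective {i} {k} e = toℕ-injective
        (IncreasingBelow.injective (sorted a) (suc (suc m)) increasing (toℕ i) (toℕ k) (toℕ<n i) (toℕ<n k) e)

    rank<size : ∀ {n y} → HasSize f a n → a ~ y → rank a y < n
    rank<size {zero} hs ay = ⊥-elim (<-irrefl refl (size-pos hs))
    rank<size {suc m} {y} hs ay with m <? rank a y
    ... | no  rank≮m = s≤s (≮⇒≥ rank≮m)
    ... | yes m<rank = ⊥-elim (<⇒≱ m<rank (rank-minimal (begin
      sorted a m          ≡⟨ sorted-stuck a m (nothing-above-last hs) (rank a y) (<⇒≤ m<rank) ⟨
      sorted a (rank a y) ≡⟨ sorted-rank ay ⟩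
      y                   ∎)))
      where open ≡-Reasoning

  finiteIndex : ℕ → ℕ → ℕ → ℕ
  finiteIndex a n y with anyUpTo? (λ j → iter F j a ≟ y) n
  ... | yes (j , _) = j
  ... | no _        = 0

  finiteIndex-spec : ∀ {a n y} → HasSize f a n → a ~ y → finiteIndex a n y < n × iter F (finiteIndex a n y) a ≡ y
  finiteIndex-spec {a} {n} {y} hs ay with anyUpTo? (λ j → iter F j a ≟ y) n
  ... | yes (_ , j<n , e) = j<n , e
  ... | no none           = ⊥-elim (none (size-iter-covers hs ay))

  finiteIndex-iter : ∀ {a n j} → HasSize f a n → j < n → finiteIndex a n (iter F j a) ≡ j
  finiteIndex-iter {a} {n} {j} hs j<n with finiteIndex-spec hs (~-iter j a)
  ... | index<n , e = size-iter-injective hs index<n j<n e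

  exponent : ℕ → ℕ → ℤ
  exponent a y with a ~? y
  ... | yes (k , _) = k
  ... | no _        = + 0

  exponent-spec : ∀ {a y} → a ~ y → pow f (exponent a y) a ≡ y
  exponent-spec {a} {y} ay with a ~? y
  ... | yes (_ , e) = e
  ... | no a≁y      = ⊥-elim (a≁y ay)

  exponent-pow : ∀ {a} → InfiniteCycle f a → ∀ k → exponent a (pow f k a) ≡ k
  exponent-pow inf k = Infinite.pow-injective inf _ k (exponent-spec (k , refl))

  -- the index of y in the enumeration of the cycle of a by powers of f (ordered by δ if infinite)
  position : ℕ → ℕ → ℕ
  position a y with finite? a
  ... | yes (n , _) = finiteIndex a n y
  ... | no _        = δ (exponent a y)

  point : ℕ → ℕ → ℕ
  point a j with finite? a
  ... | yes _ = iter F j a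
  ... | no _  = pow f (δ⁻¹ j) a

  point-~ : ∀ a j → a ~ point a j
  point-~ a j with finite? a
  ... | yes _ = ~-iter j a
  ... | no _  = δ⁻¹ j , refl

  point-position : ∀ {a y} → a ~ y → point a (position a y) ≡ y
  point-position {a} {y} ay with finite? a
  ... | yes (n , hs) = proj₂ (finiteIndex-spec hs ay)
  ... | no _         = trans (cong (λ k → pow f k a) (δ⁻¹-δ (exponent a y))) (exponent-spec ay)

  position-iter : ∀ {a n j} → HasSize f a n → j < n → position a (iter F j a) ≡ j
  position-iter {a} {n} {j} hs j<n with finite? a
  ... | yes (n′ , hs′) = finiteIndex-iter hs′ (subst (j <_) (size-unique hs hs′) j<n)
  ... | no inf         = ⊥-elim (inf (n , hs))

  position-pow : ∀ {a} → InfiniteCycle f a → ∀ k → position a (pow f k a) ≡ δ k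
  position-pow {a} inf k with finite? a
  ... | yes fin = ⊥-elim (inf fin)
  ... | no _    = cong δ (exponent-pow inf k)

  point-zero : ∀ a → point a 0 ≡ a
  point-zero a with finite? a
  ... | yes _ = refl
  ... | no _  = refl

  module _ {a} (a-least : LeastInCycle f a) where
    rank-sorted-position : ∀ {y} → a ~ y → rank a (sorted a (position a y)) ≡ position a y
    rank-sorted-position {y} ay with finite? a
    ... | yes (n , hs) = rank-sorted a-least _ λ i si<1+p →
      sorted-increasing-finite a-least hs i (≤-<-trans (≤-pred si<1+p) (proj₁ (finiteIndex-spec hs ay)))
    ... | no inf       = rank-sorted a-least _ λ i _ → sorted-increasing-infinite inf i

    position-point-rank : ∀ {y} → a ~ y → position a (point a (rank a y)) ≡ rank a y
    position-point-rank {y} ay with finite? a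
    ... | yes (n , hs) = finiteIndex-iter hs (rank<size a-least hs ay)
    ... | no inf       = trans (cong δ (exponent-pow inf (δ⁻¹ (rank a y)))) (δ-δ⁻¹ (rank a y))

    rank-self : rank a a ≡ 0
    rank-self = rank-sorted a-least 0 λ { _ (s≤s ()) }

  h h⁻¹ : ℕ → ℕ
  h   y = sorted (rep y) (position (rep y) y)
  h⁻¹ y = point (rep y) (rank (rep y) y)

  module _ {a z} (a-least : LeastInCycle f a) (az : a ~ z) where
    rep≡ : rep z ≡ a
    rep≡ = trans (sym (rep-cong az)) (rep-self a-least)

    h-on : h z ≡ sorted a (position a z)
    h-on = cong (λ b → sorted b (position b z)) rep≡

    h⁻¹-on : h⁻¹ z ≡ point a (rank a z)
    h⁻¹-on = cong (λ b → point b (rank b z)) rep≡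

  h⁻¹-h : ∀ y → h⁻¹ (h y) ≡ y
  h⁻¹-h y = begin
    h⁻¹ (h y)                                  ≡⟨ h⁻¹-on (rep-least y) (sorted-~ a (position a y)) ⟩
    point a (rank a (sorted a (position a y))) ≡⟨ cong (point a) (rank-sorted-position (rep-least y) (rep-~ y)) ⟩
    point a (position a y)                     ≡⟨ point-position (rep-~ y) ⟩
    y                                          ∎
    where
    open ≡-Reasoning
    a = rep y

  h-h⁻¹ : ∀ y → h (h⁻¹ y) ≡ y
  h-h⁻¹ y = begin
    h (h⁻¹ y)                                  ≡⟨ h-on (rep-least y) (point-~ a (rank a y)) ⟩
    sorted a (position a (point a (rank a y))) ≡⟨ cong (sorted a) (position-point-rank (rep-least y) (rep-~ y)) ⟩
    sorted a (rank a y)                        ≡⟨ sorted-rank (rep-least y) (rep-~ y) ⟩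
    y                                          ∎
    where
    open ≡-Reasoning
    a = rep y

  h⁻¹-~ : ∀ y → y ~ h⁻¹ y
  h⁻¹-~ y = ~-trans (~-sym (rep-~ y)) (point-~ (rep y) (rank (rep y) y))

  conjugator : RecPerm
  conjugator = record { fun = h ; inv = h⁻¹ ; inv-fun = h⁻¹-h ; fun-inv = h-h⁻¹ }

  g : RecPerm
  g = record
    { fun     = λ x → h (F (h⁻¹ x))
    ; inv     = λ x → h (F⁻¹ (h⁻¹ x))
    ; inv-fun = λ x → trans (cong (λ t → h (F⁻¹ t)) (h⁻¹-h (F (h⁻¹ x)))) (trans (cong h (inv-fun f (h⁻¹ x))) (h-h⁻¹ x))
    ; fun-inv = λ x → trans (cong (λ t → h (F t)) (h⁻¹-h (F⁻¹ (h⁻¹ x)))) (trans (cong h (fun-inv f (h⁻¹ x))) (h-h⁻¹ x))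
    }

  iter-conj : ∀ (φ : ℕ → ℕ) m x → iter (λ t → h (φ (h⁻¹ t))) m x ≡ h (iter φ m (h⁻¹ x))
  iter-conj φ zero    x = sym (h-h⁻¹ x)
  iter-conj φ (suc m) x = trans (cong (λ t → h (φ (h⁻¹ t))) (iter-conj φ m x)) (cong (λ t → h (φ t)) (h⁻¹-h _))

  pow-g : ∀ k x → pow g k x ≡ h (pow f k (h⁻¹ x))
  pow-g (+ m)    x = iter-conj F m x
  pow-g -[1+ m ] x = iter-conj F⁻¹ (suc m) x

  ~-conj : ∀ {x y} → h⁻¹ x ~ h⁻¹ y ⇔ x ≡[ g ] y
  ~-conj {x} {y} = mk⇔
    (λ (k , e) → k , trans (pow-g k x) (trans (cong h e) (h-h⁻¹ y)))
    (λ (k , e) → k , trans (sym (h⁻¹-h _)) (cong h⁻¹ (trans (sym (pow-g k x)) e)))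

  sameCycles : SameCycles f g
  sameCycles x y = mk⇔
    (λ xy → Equivalence.to ~-conj (~-trans (~-sym (h⁻¹-~ x)) (~-trans xy (h⁻¹-~ y))))
    (λ xy → ~-trans (h⁻¹-~ x) (~-trans (Equivalence.from ~-conj xy) (~-sym (h⁻¹-~ y))))

  h⁻¹-least : ∀ {a} → LeastInCycle f a → h⁻¹ a ≡ a
  h⁻¹-least {a} a-least = begin
    h⁻¹ a              ≡⟨ h⁻¹-on a-least ~-refl ⟩
    point a (rank a a) ≡⟨ cong (point a) (rank-self a-least) ⟩
    point a 0          ≡⟨ point-zero a ⟩
    a                  ∎
    where open ≡-Reasoning

  pow-g-least : ∀ {a} → LeastInCycle f a → ∀ k → pow g k a ≡ sorted a (position a (pow f k a))
  pow-g-least {a} a-least k = begin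
    pow g k a                         ≡⟨ pow-g k a ⟩
    h (pow f k (h⁻¹ a))               ≡⟨ cong (λ t → h (pow f k t)) (h⁻¹-least a-least) ⟩
    h (pow f k a)                     ≡⟨ h-on a-least (k , refl) ⟩
    sorted a (position a (pow f k a)) ∎
    where open ≡-Reasoning

  semiNormal : SemiNormal g
  semiNormal a g-least = infinite-increasing , finite-increasing
    where
    a-least : LeastInCycle f a
    a-least z az = g-least z (Equivalence.to (sameCycles a z) az)

    infinite-increasing : InfiniteCycle g a → ∀ j → pow g (δ⁻¹ j) a < pow g (δ⁻¹ (suc j)) a
    infinite-increasing inf j =
      subst₂ _<_ (sym (pow-g-sorted j)) (sym (pow-g-sorted (suc j))) (sorted-increasing-infinite f-inf j)
      where
      f-inf : InfiniteCycle f a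
      f-inf (n , hs) = inf (n , SameCycles-size sameCycles hs)
      pow-g-sorted : ∀ i → pow g (δ⁻¹ i) a ≡ sorted a i
      pow-g-sorted i = trans (pow-g-least a-least (δ⁻¹ i))
        (cong (sorted a) (trans (position-pow f-inf (δ⁻¹ i)) (δ-δ⁻¹ i)))

    finite-increasing : ∀ n → HasSize g a n → ∀ j → suc j < n → iter (fun g) j a < iter (fun g) (suc j) a
    finite-increasing n hs j sj<n =
      subst₂ _<_ (sym (iter-g-sorted j (<-trans (n<1+n j) sj<n))) (sym (iter-g-sorted (suc j) sj<n))
        (sorted-increasing-finite a-least f-hs j sj<n)
      where
      f-hs : HasSize f a n
      f-hs = SameCycles-size (SameCycles-sym sameCycles) hs
      iter-g-sorted : ∀ i → i < n → iter (fun g) i a ≡ sorted a i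
      iter-g-sorted i i<n = trans (pow-g-least a-least (+ i)) (cong (sorted a) (position-iter f-hs i<n))

  effConjSemiNormal : EffConjSemiNormal f
  effConjSemiNormal = g , semiNormal , sameCycles , conjugator , λ _ → refl

theorem4p5 : (f : RecPerm) → InPerm f →
    (CFDecidable f ⇔ CycleSizeFn f) × (CycleSizeFn f ⇔ EffConjSemiNormal f)
theorem4p5 f _~?_ =
  mk⇔ (CFDecidable⇒CycleSizeFn f) (CycleSizeFn⇒CFDecidable f) ,
  mk⇔ (λ ρ → SemiNormalForm.effConjSemiNormal f _~?_ (CycleSizeFn⇒CFDecidable f ρ))
      (λ c → CFDecidable⇒CycleSizeFn f (EffConjSemiNormal⇒CFDecidable f _~?_ c))
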